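{- Let $C\subseteq\mathbb{R}^d$ be any Cantor set, i.e. the attractor of an iterated function system $F=(f_1,\ldots,f_J)$ of contractions of $\mathbb{R}^d$ with contraction rates $\tau_j\in(0,1)$. Let $\tau=\max_{1\leq j\leq J}\tau_j\in(0,1)$ be the maximum contraction rate of the system and denote by $diam$ the diameter $\max\{\Vert\underline{x}-\underline{y}\Vert:\underline{x},\underline{y}\in C\}$ of the compact set $C$. Let $D=-\log J/\log\tau>0$. Then the set of rational vectors in $C$ up to height $N$, $$\mathcal{S}(C,N)=\{\underline{r}/s\in C:\ (r_1,\ldots,r_d,s)=1,\ 1\leq s\leq N\},$$ has cardinality at most $J^2\,diam^{D}\,N^{2D}$.
   Context: $\mathbb{R}^d$ carries the supremum norm $\Vert\underline{z}\Vert=\max_{1\leq j\leq d}|z_j|$. A contraction is a map $f:\mathbb{R}^d\to\mathbb{R}^d$ for which there is $\tau\in(0,1)$ (a contraction rate) with $\Vert f(\underline{x})-f(\underline{y})\Vert\leq\tau\Vert\underline{x}-\underline{y}\Vert$ for all $\underline{x},\underline{y}\in\mathbb{R}^d$. An iterated function system is a finite set of contractions; its attractor is the unique nonempty compact set $C$ with $\bigcup_{1\leq j\leq J}f_j(C)=C$. In the definition of $\mathcal{S}(C,N)$, $\underline{r}=(r_1,\ldots,r_d)\in\mathbb{Z}^d$, $s$ is a positive integer, and $(r_1,\ldots,r_d,s)$ denotes the greatest common divisor.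
   Formalization: The cardinality is bounded by max(1, J² diam^D N^{2D}), since the stated bound fails when it is below 1 and the set is nonempty (e.g. x/3 and x/3+2/81 with N=1: bound 1/2, but 0 lies in the set); D>0 is claimed only for J≥2, as D=0 for J=1. -}

module Defs where

open import Algebra.Bundles using (CommutativeRing)
import Algebra.Construct.NaturalChoice.Max as Max
import Algebra.Definitions.RawMonoid as RawMonoidDefinitions
open import Data.Fin.Base using (Fin)
open import Data.Integer.Base using (ℤ; +_; -[1+_]; ∣_∣)
open import Data.List.Base using (List)
open import Data.List.Relation.Unary.Any using (Any)
open import Data.Nat.Base as ℕ using (ℕ; suc)
open import Data.Nat.GCD using (gcd)
open import Data.Product.Base using (_×_; ∃; ∃-syntax; ∃₂; proj₁)
open import Data.Vec.Functional using (Vector; foldr; map; zipWith)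
import Data.Vec.Functional.Relation.Binary.Equality.Setoid as VectorEquality
open import Function.Bundles using (Bijection)
open import Level using (0ℓ)
open import Relation.Binary.Bundles using (DecTotalOrder; Setoid)
open import Relation.Binary.Core using (Rel)
import Relation.Binary.Construct.NonStrictToStrict as NonStrictToStrict
import Relation.Binary.Construct.On as On
open import Relation.Binary.PropositionalEquality using (_≡_; setoid)
open import Relation.Binary.Structures using (IsDecTotalOrder)
open import Relation.Nullary.Decidable.Core using (yes; no)
open import Relation.Nullary.Negation.Core using (¬_)
open import Relation.Unary using (Pred; _∈_; _⊆_; _≐_; ⋃; Satisfiable)

-- ℝ is characterised, up to a unique isomorphism, as a Dedekind-complete
-- ordered field.  Equality is the setoid equality of the ring.  Decidability
-- of the order and least upper bounds for arbitrary predicates are classical;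
-- they are to be read together with excluded middle.

record CompleteOrderedField : Set₁ where
  field
    commutativeRing : CommutativeRing 0ℓ 0ℓ

  open CommutativeRing commutativeRing public

  infix 4 _≤_
  infix 8 _⁻¹

  field
    _≤_             : Rel Carrier 0ℓ
    isDecTotalOrder : IsDecTotalOrder _≈_ _≤_
    0≉1             : ¬ (0# ≈ 1#)
    -- The value of 0# ⁻¹ is unspecified.
    _⁻¹             : Carrier → Carrier
    ⁻¹-inverse      : ∀ {x} → ¬ (x ≈ 0#) → x * x ⁻¹ ≈ 1#
    +-monoʳ-≤       : ∀ z {x y} → x ≤ y → z + x ≤ z + y
    *-nonNegative   : ∀ {x y} → 0# ≤ x → 0# ≤ y → 0# ≤ x * y

  IsUpperBound : Pred Carrier 0ℓ → Pred Carrier 0ℓ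
  IsUpperBound P b = ∀ {x} → x ∈ P → x ≤ b

  field
    complete : (P : Pred Carrier 0ℓ) → Satisfiable P → Satisfiable (IsUpperBound P) →
               ∃[ s ] IsUpperBound P s × (∀ {b} → b ∈ IsUpperBound P → s ≤ b)

  decTotalOrder : DecTotalOrder 0ℓ 0ℓ 0ℓ
  decTotalOrder = record { isDecTotalOrder = isDecTotalOrder }

  open DecTotalOrder decTotalOrder public using (_≤?_; _≟_; totalOrder)
  open NonStrictToStrict _≈_ _≤_ public using (_<_)
  open Max totalOrder public using (_⊔_)

-- The natural exponential is the only map satisfying exp-+ and 1+x≤exp
-- (the latter fixes the base e), and log is its inverse on the positive reals.
-- The value of log on nonpositive reals is unspecified.

record Exponential (ℝ : CompleteOrderedField) : Set where
  open CompleteOrderedField ℝ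
  field
    exp      : Carrier → Carrier
    exp-cong : ∀ {x y} → x ≈ y → exp x ≈ exp y
    exp-+    : ∀ x y → exp (x + y) ≈ exp x * exp y
    1+x≤exp  : ∀ x → 1# + x ≤ exp x
    log      : Carrier → Carrier
    exp-log  : ∀ {x} → 0# < x → exp (log x) ≈ x

module Euclidean (ℝ : CompleteOrderedField) (E : Exponential ℝ) where
  open CompleteOrderedField ℝ public hiding (setoid)
  open Exponential E public

  private
    realSetoid : Setoid 0ℓ 0ℓ
    realSetoid = CompleteOrderedField.setoid ℝ

  fromℕ : ℕ → Carrier
  fromℕ n = RawMonoidDefinitions._×_ +-rawMonoid n 1#

  fromℤ : ℤ → Carrier
  fromℤ (+ n)    = fromℕ n
  fromℤ -[1+ n ] = - fromℕ (suc n)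

  infixl 7 _/_
  _/_ : Carrier → Carrier → Carrier
  x / y = x * y ⁻¹

  ∣_∣ʳ : Carrier → Carrier
  ∣ x ∣ʳ = x ⊔ (- x)

  -- Real powers of nonnegative bases, with 0 ^ 0 = 1 and 0 ^ a = 0 otherwise;
  -- the values at negative bases are irrelevant.
  infixr 8 _^_
  _^_ : Carrier → Carrier → Carrier
  x ^ a with x ≤? 0# | a ≟ 0#
  ... | no  _ | _     = exp (a * log x)
  ... | yes _ | yes _ = 1#
  ... | yes _ | no  _ = 0#

  IsMaximum : Pred Carrier 0ℓ → Pred Carrier 0ℓ
  IsMaximum P m = m ∈ P × IsUpperBound P m

  Point : ℕ → Set
  Point d = Vector Carrier d

  pointSetoid : ℕ → Setoid 0ℓ 0ℓ
  pointSetoid = VectorEquality.≋-setoid realSetoid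

  infix 4 _≋_
  _≋_ : ∀ {d} → Rel (Point d) 0ℓ
  _≋_ {d} = Setoid._≈_ (pointSetoid d)

  infixl 6 _⊖_
  _⊖_ : ∀ {d} → Point d → Point d → Point d
  _⊖_ = zipWith _-_

  -- Starting the fold at 0 does not affect the maximum of absolute values.
  ‖_‖ : ∀ {d} → Point d → Carrier
  ‖ z ‖ = foldr _⊔_ 0# (map ∣_∣ʳ z)

  IsContraction : ∀ {d} → (Point d → Point d) → Pred Carrier 0ℓ
  IsContraction f τ =
    0# < τ × τ < 1# × (∀ x y → ‖ f x ⊖ f y ‖ ≤ τ * ‖ x ⊖ y ‖)

  IsOpen : ∀ {d} → Pred (Point d) 0ℓ → Set
  IsOpen U = ∀ x → x ∈ U → ∃[ ε ] 0# < ε × (∀ y → ‖ x ⊖ y ‖ < ε → y ∈ U)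

  IsCompact : ∀ {d} → Pred (Point d) 0ℓ → Set₁
  IsCompact {d} C = {I : Set} (U : I → Pred (Point d) 0ℓ) → (∀ i → IsOpen (U i)) →
    C ⊆ ⋃ I U → ∃ λ (is : List I) → C ⊆ λ x → Any (λ i → x ∈ U i) is

  image : ∀ {d} → (Point d → Point d) → Pred (Point d) 0ℓ → Pred (Point d) 0ℓ
  image f P y = ∃[ x ] x ∈ P × y ≋ f x

  -- Since images are closed under _≋_, so is every attractor.
  IsAttractor : ∀ {d J} → Vector (Point d → Point d) J → Pred (Point d) 0ℓ → Set₁
  IsAttractor {J = J} F C =
    Satisfiable C × IsCompact C × ⋃ (Fin J) (λ j → image (F j) C) ≐ C

  distances : ∀ {d} → Pred (Point d) 0ℓ → Pred Carrier 0ℓ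
  distances C t = ∃₂ λ x y → x ∈ C × y ∈ C × t ≈ ‖ x ⊖ y ‖

  IsDiameter : ∀ {d} → Pred (Point d) 0ℓ → Pred Carrier 0ℓ
  IsDiameter C = IsMaximum (distances C)

  IsMaximumRate : ∀ {J} → Vector Carrier J → Pred Carrier 0ℓ
  IsMaximumRate τs = IsMaximum (λ t → ∃[ j ] t ≈ τs j)

  gcdAll : ∀ {d} → Vector ℤ d → ℕ → ℕ
  gcdAll r s = foldr (λ rᵢ g → gcd ∣ rᵢ ∣ g) s r

  rationalPoint : ∀ {d} → Vector ℤ d → ℕ → Point d
  rationalPoint r s = map (λ rᵢ → fromℤ rᵢ / fromℕ s) r

  𝒮 : ∀ {d} → Pred (Point d) 0ℓ → ℕ → Pred (Point d) 0ℓ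
  𝒮 C N z = z ∈ C × (∃₂ λ r s →
    gcdAll r s ≡ 1 × 1 ℕ.≤ s × s ℕ.≤ N × z ≋ rationalPoint r s)

  HasCardinality : ∀ {d} → Pred (Point d) 0ℓ → ℕ → Set
  HasCardinality {d} P n =
    Bijection (setoid (Fin n)) (On.setoid {B = ∃ P} (pointSetoid d) proj₁)

  exponent : ℕ → Carrier → Carrier
  exponent J τ = (- log (fromℕ J)) / log τ

  -- J² diam^D N^{2D}.  This can be smaller than 1 while 𝒮 C N is nonempty, so
  -- it bounds the cardinality only in the form max(1, bound).  For example
  -- x ↦ x/3 and x ↦ x/3 + 2/81 on the line have an attractor of diameter 1/27
  -- containing 0; with N = 1 and D = log 2 / log 3 the bound is 1/2.
  bound : ℕ → Carrier → Carrier → ℕ → Carrier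
  bound J diam D N =
    fromℕ (J ℕ.^ 2) * diam ^ D * fromℕ N ^ (fromℕ 2 * D)

{-# OPTIONS --safe #-}

-- Choose k minimal with τᵏ · diam < N⁻².  The Jᵏ images of C under the k-fold
-- compositions of the fⱼ cover C and have diameter less than N⁻², while distinct
-- rational vectors of height at most N are at distance at least N⁻²; hence
-- #𝒮 C N ≤ Jᵏ.  If k = 0 this is 1; otherwise τᵏ⁻¹ · diam ≥ N⁻², and as
-- J = τ⁻ᴰ, this gives Jᵏ⁻¹ ≤ (N² diam)ᴰ.
module Submission where

open import Defs
open import Axiom.ExcludedMiddle using (ExcludedMiddle)
import Algebra.Construct.NaturalChoice.MaxOp as MaxOp
import Algebra.Construct.NaturalChoice.Max as Max
import Algebra.Properties.AbelianGroup as AbelianGroupProperties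
import Algebra.Properties.Ring as RingProperties
import Algebra.Properties.Semiring.Mult as Mult
import Algebra.Solver.Ring.NaturalCoefficients.Default as SemiringSolver
open import Data.Fin.Base using (Fin; zero; suc; remQuot; combine)
open import Data.Fin.Properties using (nonZeroIndex; remQuot-combine)
open import Data.Integer.Base using (+_; -[1+_])
open import Data.List.Base using ([]; _∷_; length; lookup)
open import Data.List.Membership.Propositional.Properties using (∈-lookup)
open import Data.List.Relation.Unary.All using ([]; _∷_)
import Data.List.Relation.Unary.All as All
open import Data.List.Relation.Unary.All.Properties using (¬Any⇒All¬)
open import Data.List.Relation.Unary.AllPairs using (AllPairs; []; _∷_)
open import Data.List.Relation.Unary.Any using (Any; here; there; index)
import Data.List.Relation.Unary.Any as Any
open import Data.List.Relation.Unary.Any.Properties using (lookup-index)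
open import Data.Nat.Base as ℕ using (ℕ; zero; suc; z≤n; s≤s)
import Data.Nat.Properties as ℕ
open import Data.Product.Base using (_×_; _,_; ∃; ∃-syntax; ∃₂; proj₁; proj₂)
open import Data.Sum.Base using (inj₁; inj₂)
open import Data.Vec.Functional using (Vector; tail)
open import Data.Vec.Functional.Relation.Binary.Equality.Setoid using (foldr-cong)
open import Function.Base using (_∘_)
open import Function.Bundles using (Bijection)
open import Level using (0ℓ)
open import Relation.Binary.Bundles using (Setoid; DecTotalOrder)
import Relation.Binary.Construct.On as On
open import Relation.Binary.PropositionalEquality as ≡ using (_≡_)
import Relation.Binary.Properties.DecTotalOrder as DecTotalOrderProperties
import Relation.Binary.Reasoning.PartialOrder as PartialOrderReasoning
open import Relation.Nullary.Decidable.Core using (Dec; yes; no)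
open import Relation.Nullary.Negation.Core using (contradiction)
open import Relation.Unary using (Pred; _∈_)

-- Counting a setoid covered by finitely many thin cells

module Counting (em : ExcludedMiddle 0ℓ) (S : Setoid 0ℓ 0ℓ) where
  open Setoid S renaming (Carrier to A)

  -- Induction on the number of cells. Excluded middle decides whether the first cell is inhabited
  -- and, if so, whether its element `x` is already represented by the other cells. Cells may
  -- overlap or be empty, so `m` is only an upper bound for the length. Thinness lets one
  -- representative serve a whole cell.
  transversal : ∀ {m} (cell : Fin m → Pred A 0ℓ) →
                (∀ i {a b} → a ∈ cell i → b ∈ cell i → a ≈ b) →
                ∃[ xs ] length xs ℕ.≤ m × AllPairs _≉_ xs ×
                  (∀ {a} i → a ∈ cell i → Any (a ≈_) xs)
  transversal {zero}  cell thin = [] , z≤n , [] , λ ()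
  transversal {suc m} cell thin
    with transversal (cell ∘ suc) (thin ∘ suc) | em {∃[ a ] a ∈ cell zero}
  ... | xs , len , distinct , covers | no empty =
    xs , ℕ.m≤n⇒m≤1+n len , distinct , λ
      { zero    a∈ → contradiction (_ , a∈) empty
      ; (suc i) a∈ → covers i a∈ }
  ... | xs , len , distinct , covers | yes (x , x∈) with em {Any (x ≈_) xs}
  ...   | yes found = xs , ℕ.m≤n⇒m≤1+n len , distinct , λ
      { zero    a∈ → Any.map (trans (thin zero a∈ x∈)) found
      ; (suc i) a∈ → covers i a∈ }
  ...   | no missing = x ∷ xs , s≤s len , ¬Any⇒All¬ xs missing ∷ distinct , λ
      { zero    a∈ → here (thin zero a∈ x∈)
      ; (suc i) a∈ → there (covers i a∈) }

  lookup-injective : ∀ {xs} → AllPairs _≉_ xs → ∀ i j →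
                     lookup xs i ≈ lookup xs j → i ≡ j
  lookup-injective (_  ∷ _) zero    zero    _ = ≡.refl
  lookup-injective (x≉ ∷ _) zero    (suc j) p = contradiction p (All.lookup x≉ (∈-lookup j))
  lookup-injective (x≉ ∷ _) (suc i) zero    p = contradiction (sym p) (All.lookup x≉ (∈-lookup i))
  lookup-injective (_  ∷ d) (suc i) (suc j) p = ≡.cong suc (lookup-injective d i j p)

  -- Looking up positions in a transversal is the required bijection: its entries are pairwise
  -- inequivalent, which gives injectivity, and every element lies in some cell, which gives
  -- surjectivity.
  cardinality-≤ : ∀ {m} (cell : Fin m → Pred A 0ℓ) →
                  (∀ i {a b} → a ∈ cell i → b ∈ cell i → a ≈ b) →
                  (∀ a → ∃[ i ] a ∈ cell i) →
                  ∃[ n ] Bijection (≡.setoid (Fin n)) S × n ℕ.≤ m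
  cardinality-≤ cell thin total with transversal cell thin
  ... | xs , len , distinct , covers = length xs , bijection , len
    where
    bijection : Bijection (≡.setoid (Fin (length xs))) S
    bijection = record
      { to        = lookup xs
      ; cong      = λ { ≡.refl → refl }
      ; bijective = (λ {i} {j} → lookup-injective distinct i j) , λ a →
          let found = covers _ (proj₂ (total a)) in
          index found , λ { ≡.refl → sym (lookup-index found) }
      }

module Analysis (ℝ : CompleteOrderedField) (E : Exponential ℝ) where
  open Euclidean ℝ E hiding (zero)
  open DecTotalOrder decTotalOrder
    using (poset; total; ≤-respˡ-≈; ≤-respʳ-≈)
    renaming (refl to ≤-refl; reflexive to ≤-reflexive; trans to ≤-trans)
  open DecTotalOrderProperties decTotalOrder
    using (<⇒≱; ≰⇒>; ≮⇒≥; <-respʳ-≈; <-respˡ-≈)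
  open PartialOrderReasoning poset
  open RingProperties ring using (-‿distribˡ-*; -‿distribʳ-*; [y-z]x≈yx-zx; x[y-z]≈xy-xz)
  open AbelianGroupProperties +-abelianGroup
    using (\\-leftDividesʳ; //-rightDividesˡ; x∙y⁻¹≈ε⇒x≈y; ⁻¹-anti-homo‿-; ⁻¹-∙-comm)
    renaming (∙-cancelˡ to +-cancelˡ; ⁻¹-involutive to -‿involutive)
  open Mult semiring using (×-homo-+; ×1-homo-*)
  open SemiringSolver commutativeSemiring using (solve; _:=_; _:+_; _:*_; con)
  open MaxOp (Max.maxOperator totalOrder)
    using (⊔-cong; x≤x⊔y; x≤y⊔x; x≤y⇒x≤y⊔z; x≤y⇒x≤z⊔y)

  -- Arithmetic in an ordered field

  +-monoˡ-≤ : ∀ z {x y} → x ≤ y → x + z ≤ y + z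
  +-monoˡ-≤ z {x} {y} x≤y = begin
    x + z  ≈⟨ +-comm x z ⟩
    z + x  ≤⟨ +-monoʳ-≤ z x≤y ⟩
    z + y  ≈⟨ +-comm z y ⟩
    y + z  ∎

  +-cancelˡ-≤ : ∀ z {x y} → z + x ≤ z + y → x ≤ y
  +-cancelˡ-≤ z {x} {y} p = begin
    x              ≈⟨ \\-leftDividesʳ z x ⟨
    - z + (z + x)  ≤⟨ +-monoʳ-≤ (- z) p ⟩
    - z + (z + y)  ≈⟨ \\-leftDividesʳ z y ⟩
    y              ∎

  +-monoʳ-< : ∀ z {x y} → x < y → z + x < z + y
  +-monoʳ-< z (x≤y , x≉y) = +-monoʳ-≤ z x≤y , λ e → x≉y (+-cancelˡ z _ _ e)

  x≤y⇒0≤y-x : ∀ {x y} → x ≤ y → 0# ≤ y - x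
  x≤y⇒0≤y-x {x} {y} x≤y = begin
    0#     ≈⟨ -‿inverseʳ x ⟨
    x - x  ≤⟨ +-monoˡ-≤ (- x) x≤y ⟩
    y - x  ∎

  0≤y-x⇒x≤y : ∀ {x y} → 0# ≤ y - x → x ≤ y
  0≤y-x⇒x≤y {x} {y} p = +-cancelˡ-≤ (- x) (begin
    - x + x  ≈⟨ -‿inverseˡ x ⟩
    0#       ≤⟨ p ⟩
    y - x    ≈⟨ +-comm y (- x) ⟩
    - x + y  ∎)

  x<y⇒0<y-x : ∀ {x y} → x < y → 0# < y - x
  x<y⇒0<y-x (x≤y , x≉y) =
    x≤y⇒0≤y-x x≤y , λ e → x≉y (sym (x∙y⁻¹≈ε⇒x≈y _ _ (sym e)))

  *-monoˡ-≤ : ∀ {z} → 0# ≤ z → ∀ {x y} → x ≤ y → z * x ≤ z * y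
  *-monoˡ-≤ {z} 0≤z {x} {y} x≤y = 0≤y-x⇒x≤y (begin
    0#             ≤⟨ *-nonNegative 0≤z (x≤y⇒0≤y-x x≤y) ⟩
    z * (y - x)    ≈⟨ x[y-z]≈xy-xz z y x ⟩
    z * y - z * x  ∎)

  *-monoʳ-≤ : ∀ {z} → 0# ≤ z → ∀ {x y} → x ≤ y → x * z ≤ y * z
  *-monoʳ-≤ {z} 0≤z {x} {y} x≤y = begin
    x * z  ≈⟨ *-comm x z ⟩
    z * x  ≤⟨ *-monoˡ-≤ 0≤z x≤y ⟩
    z * y  ≈⟨ *-comm z y ⟩
    y * z  ∎

  *-cancelˡ-≈ : ∀ {z} → z ≉ 0# → ∀ {x y} → z * x ≈ z * y → x ≈ y
  *-cancelˡ-≈ {z} z≉0 {x} {y} e = begin-equality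
    x               ≈⟨ unit x ⟨
    z ⁻¹ * (z * x)  ≈⟨ *-congˡ e ⟩
    z ⁻¹ * (z * y)  ≈⟨ unit y ⟩
    y               ∎
    where
    unit : ∀ w → z ⁻¹ * (z * w) ≈ w
    unit w = begin-equality
      z ⁻¹ * (z * w)  ≈⟨ solve 3 (λ i z w → i :* (z :* w) := (z :* i) :* w) refl (z ⁻¹) z w ⟩
      z * z ⁻¹ * w    ≈⟨ *-congʳ (⁻¹-inverse z≉0) ⟩
      1# * w          ≈⟨ *-identityˡ w ⟩
      w               ∎

  *-monoˡ-< : ∀ {z} → 0# < z → ∀ {x y} → x < y → z * x < z * y
  *-monoˡ-< (0≤z , 0≉z) (x≤y , x≉y) =
    *-monoˡ-≤ 0≤z x≤y , λ e → x≉y (*-cancelˡ-≈ (0≉z ∘ sym) e)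

  *-cancelˡ-≤ : ∀ {z} → 0# < z → ∀ {x y} → z * x ≤ z * y → x ≤ y
  *-cancelˡ-≤ 0<z {x} {y} p with x ≤? y
  ... | yes x≤y = x≤y
  ... | no  x≰y = contradiction p (<⇒≱ (*-monoˡ-< 0<z (≰⇒> x≰y)))

  0<1 : 0# < 1#
  0<1 with total 0# 1#
  ... | inj₁ 0≤1 = 0≤1 , 0≉1
  ... | inj₂ 1≤0 = 0≤1 , 0≉1
    where
    -- If 1 were at most 0, then -1 would be nonnegative, and so would its square, which is 1.
    0≤-1 : 0# ≤ - 1#
    0≤-1 = ≤-respʳ-≈ (+-identityˡ (- 1#)) (x≤y⇒0≤y-x 1≤0)
    0≤1 : 0# ≤ 1#
    0≤1 = begin
      0#             ≤⟨ *-nonNegative 0≤-1 0≤-1 ⟩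
      - 1# * - 1#    ≈⟨ -‿distribˡ-* 1# (- 1#) ⟨
      - (1# * - 1#)  ≈⟨ -‿cong (*-identityˡ (- 1#)) ⟩
      - - 1#         ≈⟨ -‿involutive 1# ⟩
      1#             ∎

  fromℕ-mono-≤ : ∀ {m n} → m ℕ.≤ n → fromℕ m ≤ fromℕ n
  fromℕ-mono-≤ {n = zero}  z≤n = ≤-refl
  fromℕ-mono-≤ {n = suc n} z≤n = begin
    0#            ≤⟨ fromℕ-mono-≤ (z≤n {n}) ⟩
    fromℕ n       ≈⟨ +-identityˡ _ ⟨
    0# + fromℕ n  ≤⟨ +-monoˡ-≤ _ (proj₁ 0<1) ⟩
    1# + fromℕ n  ∎
  fromℕ-mono-≤ (s≤s m≤n) = +-monoʳ-≤ 1# (fromℕ-mono-≤ m≤n)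

  0≤fromℕ : ∀ n → 0# ≤ fromℕ n
  0≤fromℕ n = fromℕ-mono-≤ {n = n} z≤n

  0≤fromℕ² : ∀ n → 0# ≤ fromℕ n * fromℕ n
  0≤fromℕ² n = *-nonNegative (0≤fromℕ n) (0≤fromℕ n)

  fromℕ-1 : fromℕ 1 ≈ 1#
  fromℕ-1 = +-identityʳ 1#

  1≤fromℕ : ∀ {n} → 1 ℕ.≤ n → 1# ≤ fromℕ n
  1≤fromℕ 1≤n = ≤-respˡ-≈ fromℕ-1 (fromℕ-mono-≤ 1≤n)

  0<fromℕ : ∀ {n} → 1 ℕ.≤ n → 0# < fromℕ n
  0<fromℕ {n} 1≤n = begin-strict
    0#       <⟨ 0<1 ⟩
    1#       ≤⟨ 1≤fromℕ 1≤n ⟩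
    fromℕ n  ∎

  -- Integrality enters here: `m > n` already means `m ≥ n + 1`, so a strict bound by `n + 1`
  -- suffices.
  fromℕ-cancel-≤ : ∀ m n → fromℕ m < 1# + fromℕ n → m ℕ.≤ n
  fromℕ-cancel-≤ m n p with m ℕ.≤? n
  ... | yes m≤n = m≤n
  ... | no  m≰n = contradiction (fromℕ-mono-≤ (ℕ.≰⇒> m≰n)) (<⇒≱ p)

  -- Exponential and logarithm

  -- The product of `exp x` and `exp (- x)` is `exp 0`, which is at least 1, so neither factor can
  -- vanish.
  exp≉0 : ∀ x → exp x ≉ 0#
  exp≉0 x e = <⇒≱ 0<1 (begin
    1#                  ≈⟨ +-identityʳ 1# ⟨
    1# + 0#             ≤⟨ 1+x≤exp 0# ⟩
    exp 0#              ≈⟨ exp-cong (-‿inverseʳ x) ⟨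
    exp (x - x)         ≈⟨ exp-+ x (- x) ⟩
    exp x * exp (- x)   ≈⟨ *-congʳ e ⟩
    0# * exp (- x)      ≈⟨ zeroˡ _ ⟩
    0#                  ∎)

  -- By additivity `exp 0` equals its own square, and a nonzero factor can be cancelled.
  exp-0 : exp 0# ≈ 1#
  exp-0 = *-cancelˡ-≈ (exp≉0 0#) (begin-equality
    exp 0# * exp 0#  ≈⟨ exp-+ 0# 0# ⟨
    exp (0# + 0#)    ≈⟨ exp-cong (+-identityˡ 0#) ⟩
    exp 0#           ≈⟨ *-identityʳ _ ⟨
    exp 0# * 1#      ∎)

  0≤x⇒0<exp : ∀ {x} → 0# ≤ x → 0# < exp x
  0≤x⇒0<exp {x} 0≤x = begin-strict
    0#       <⟨ 0<1 ⟩
    1#       ≈⟨ +-identityʳ 1# ⟨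
    1# + 0#  ≤⟨ +-monoʳ-≤ 1# 0≤x ⟩
    1# + x   ≤⟨ 1+x≤exp x ⟩
    exp x    ∎

  0<exp : ∀ x → 0# < exp x
  0<exp x with total 0# x
  ... | inj₁ 0≤x = 0≤x⇒0<exp 0≤x
  -- For `x ≤ 0` the linear lower bound may be negative. Instead `exp (- x)` is positive by the
  -- first case and its product with `exp x` is 1.
  ... | inj₂ x≤0 = *-cancelˡ-≤ 0<exp[-x] (begin
      exp (- x) * 0#     ≈⟨ zeroʳ _ ⟩
      0#                 ≤⟨ proj₁ 0<1 ⟩
      1#                 ≈⟨ exp-0 ⟨
      exp 0#             ≈⟨ exp-cong (-‿inverseˡ x) ⟨
      exp (- x + x)      ≈⟨ exp-+ (- x) x ⟩
      exp (- x) * exp x  ∎) , λ e → exp≉0 x (sym e)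
    where
    0<exp[-x] : 0# < exp (- x)
    0<exp[-x] = 0≤x⇒0<exp (≤-respʳ-≈ (+-identityˡ (- x)) (x≤y⇒0≤y-x x≤0))

  -- The quotient of the two values is `exp (y - x)`, which exceeds 1 because it is at least
  -- `1 + (y - x)`.
  exp-mono-< : ∀ {x y} → x < y → exp x < exp y
  exp-mono-< {x} {y} x<y = begin-strict
    exp x                ≈⟨ *-identityʳ _ ⟨
    exp x * 1#           <⟨ *-monoˡ-< (0<exp x) 1<exp ⟩
    exp x * exp (y - x)  ≈⟨ exp-+ x (y - x) ⟨
    exp (x + (y - x))    ≈⟨ exp-cong (+-comm x (y - x)) ⟩
    exp (y - x + x)      ≈⟨ exp-cong (//-rightDividesˡ x y) ⟩
    exp y                ∎
    where
    1<exp : 1# < exp (y - x)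
    1<exp = begin-strict
      1#            ≈⟨ +-identityʳ 1# ⟨
      1# + 0#       <⟨ +-monoʳ-< 1# (x<y⇒0<y-x x<y) ⟩
      1# + (y - x)  ≤⟨ 1+x≤exp (y - x) ⟩
      exp (y - x)   ∎

  exp-mono-≤ : ∀ {x y} → x ≤ y → exp x ≤ exp y
  exp-mono-≤ {x} {y} x≤y with x ≟ y
  ... | yes x≈y = ≤-reflexive (exp-cong x≈y)
  ... | no  x≉y = proj₁ (exp-mono-< (x≤y , x≉y))

  exp-cancel-≤ : ∀ {x y} → exp x ≤ exp y → x ≤ y
  exp-cancel-≤ {x} {y} p with x ≤? y
  ... | yes x≤y = x≤y
  ... | no  x≰y = contradiction p (<⇒≱ (exp-mono-< (≰⇒> x≰y)))

  exp-cancel-< : ∀ {x y} → exp x < exp y → x < y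
  exp-cancel-< (p , ≉) = exp-cancel-≤ p , λ x≈y → ≉ (exp-cong x≈y)

  0<x<1⇒log<0 : ∀ {x} → 0# < x → x < 1# → log x < 0#
  0<x<1⇒log<0 {x} 0<x x<1 = exp-cancel-< (begin-strict
    exp (log x)  ≈⟨ exp-log 0<x ⟩
    x            <⟨ x<1 ⟩
    1#           ≈⟨ exp-0 ⟨
    exp 0#       ∎)

  1<x⇒0<log : ∀ {x} → 1# < x → 0# < log x
  1<x⇒0<log {x} 1<x = exp-cancel-< (begin-strict
    exp 0#       ≈⟨ exp-0 ⟩
    1#           <⟨ 1<x ⟩
    x            ≈⟨ exp-log 0<x ⟨
    exp (log x)  ∎)
    where
    0<x : 0# < x
    0<x = begin-strict 0# <⟨ 0<1 ⟩ 1# <⟨ 1<x ⟩ x ∎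

  1≤x⇒0≤log : ∀ {x} → 1# ≤ x → 0# ≤ log x
  1≤x⇒0≤log {x} 1≤x = exp-cancel-≤ (begin
    exp 0#       ≈⟨ exp-0 ⟩
    1#           ≤⟨ 1≤x ⟩
    x            ≈⟨ exp-log 0<x ⟨
    exp (log x)  ∎)
    where
    0<x : 0# < x
    0<x = begin-strict 0# <⟨ 0<1 ⟩ 1# ≤⟨ 1≤x ⟩ x ∎

  -- This passes from the number of cells, a power in `ℕ`, to the exponential form in which it is
  -- compared with the bound.
  exp-*-log-fromℕ : ∀ m {J} → 1 ℕ.≤ J →
                    exp (fromℕ m * log (fromℕ J)) ≈ fromℕ (J ℕ.^ m)
  exp-*-log-fromℕ zero {J} 1≤J = begin-equality
    exp (0# * log (fromℕ J))  ≈⟨ exp-cong (zeroˡ _) ⟩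
    exp 0#                    ≈⟨ exp-0 ⟩
    1#                        ≈⟨ fromℕ-1 ⟨
    fromℕ 1                   ∎
  exp-*-log-fromℕ (suc m) {J} 1≤J = begin-equality
    exp ((1# + fromℕ m) * l)    ≈⟨ exp-cong (distribʳ l 1# (fromℕ m)) ⟩
    exp (1# * l + fromℕ m * l)  ≈⟨ exp-cong (+-congʳ (*-identityˡ l)) ⟩
    exp (l + fromℕ m * l)       ≈⟨ exp-+ l (fromℕ m * l) ⟩
    exp l * exp (fromℕ m * l)   ≈⟨ *-cong (exp-log (0<fromℕ 1≤J)) (exp-*-log-fromℕ m 1≤J) ⟩
    fromℕ J * fromℕ (J ℕ.^ m)   ≈⟨ ×1-homo-* J (J ℕ.^ m) ⟨
    fromℕ (J ℕ.* J ℕ.^ m)       ∎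
    where l = log (fromℕ J)

  ^-positive : ∀ {x} → 0# < x → ∀ a → x ^ a ≈ exp (a * log x)
  ^-positive {x} 0<x a with x ≤? 0# | a ≟ 0#
  ... | no  _   | _ = refl
  ... | yes x≤0 | _ = contradiction x≤0 (<⇒≱ 0<x)

  -- Archimedean property and integer part

  archimedean : ExcludedMiddle 0ℓ → ∀ {x} → 0# < x → ∀ y → ∃[ n ] y < fromℕ n * x
  archimedean em {x} 0<x y with em {∃[ n ] y < fromℕ n * x}
  ... | yes found = found
  ... | no  none  = contradiction s≤s-x (<⇒≱ s-x<s)
    where
    Multiple : Pred Carrier 0ℓ
    Multiple z = ∃[ n ] z ≈ fromℕ n * x
    bounded : IsUpperBound Multiple y
    bounded (n , z≈) = ≤-respˡ-≈ (sym z≈) (≮⇒≥ λ y<nx → none (n , y<nx))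
    supremum = complete Multiple (_ , 0 , refl) (y , bounded)
    s = proj₁ supremum
    s-x<s : s - x < s
    s-x<s = begin-strict
      s - x        ≈⟨ +-identityʳ _ ⟨
      s - x + 0#   <⟨ +-monoʳ-< (s - x) 0<x ⟩
      s - x + x    ≈⟨ //-rightDividesˡ x s ⟩
      s            ∎
    -- If no multiple of `x` exceeds `y`, the multiples have a supremum `s`. Adding `x` to a
    -- multiple gives another one, again at most `s`, so `s - x` is a smaller upper bound.
    s≤s-x : s ≤ s - x
    s≤s-x = proj₂ (proj₂ supremum) λ { {z} (n , z≈) → +-cancelˡ-≤ x (begin
      x + z                ≈⟨ +-cong (sym (*-identityˡ x)) z≈ ⟩
      1# * x + fromℕ n * x ≈⟨ distribʳ x 1# (fromℕ n) ⟨
      (1# + fromℕ n) * x   ≤⟨ proj₁ (proj₂ supremum) (suc n , refl) ⟩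
      s                    ≈⟨ //-rightDividesˡ x s ⟨
      s - x + x            ≈⟨ +-comm (s - x) x ⟩
      x + (s - x)          ∎) }

  floor : ExcludedMiddle 0ℓ → ∀ {x y} → 0# < x → 0# ≤ y →
          ∃[ m ] fromℕ m * x ≤ y × y < fromℕ (suc m) * x
  floor em {x} {y} 0<x 0≤y = let n , y<nx = archimedean em 0<x y in descend n y<nx
    where
    -- The invariant is `y < n x`. The descent stops at the first `n` for which the lower inequality
    -- holds; `0≤y` keeps it from reaching zero.
    descend : ∀ n → y < fromℕ n * x → ∃[ m ] fromℕ m * x ≤ y × y < fromℕ (suc m) * x
    descend zero    y<0 = contradiction 0≤y (<⇒≱ (<-respʳ-≈ (zeroˡ x) y<0))
    descend (suc n) y<  with fromℕ n * x ≤? y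
    ... | yes nx≤y = n , nx≤y , y<
    ... | no  nx≰y = descend n (≰⇒> nx≰y)

  -- The supremum norm

  ⊖-cong-‖‖ : ∀ {d} {x x′ y y′ : Point d} → x ≋ x′ → y ≋ y′ → ‖ x ⊖ y ‖ ≈ ‖ x′ ⊖ y′ ‖
  ⊖-cong-‖‖ x≋ y≋ = foldr-cong (CompleteOrderedField.setoid ℝ) ⊔-cong refl λ i →
    let e = +-cong (x≋ i) (-‿cong (y≋ i)) in ⊔-cong e (-‿cong e)

  0≤‖‖ : ∀ {d} (z : Point d) → 0# ≤ ‖ z ‖
  0≤‖‖ {zero}  z = ≤-refl
  0≤‖‖ {suc d} z = x≤y⇒x≤z⊔y _ (0≤‖‖ (tail z))

  ∣zᵢ∣≤‖z‖ : ∀ {d} (z : Point d) i → ∣ z i ∣ʳ ≤ ‖ z ‖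
  ∣zᵢ∣≤‖z‖ z zero    = x≤x⊔y _ _
  ∣zᵢ∣≤‖z‖ z (suc i) = x≤y⇒x≤z⊔y _ (∣zᵢ∣≤‖z‖ (tail z) i)

  -- Separation of rational points

  -- Differences of naturals spare us the proof that fromℤ is a ring homomorphism.
  IsIntegral : Pred Carrier 0ℓ
  IsIntegral x = ∃₂ λ m n → x ≈ fromℕ m - fromℕ n

  -- Applied to the cross products `p t` and `q s` that form the numerator of `p/s - q/t`.
  IsIntegral-ℤ*ℕ : ∀ z s → IsIntegral (fromℤ z * fromℕ s)
  IsIntegral-ℤ*ℕ (+ n) s = n ℕ.* s , 0 , (begin-equality
    fromℕ n * fromℕ s     ≈⟨ ×1-homo-* n s ⟨
    fromℕ (n ℕ.* s)       ≈⟨ //-rightDividesˡ 0# _ ⟨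
    fromℕ (n ℕ.* s) - 0# + 0#  ≈⟨ +-identityʳ _ ⟩
    fromℕ (n ℕ.* s) - 0#  ∎)
  IsIntegral-ℤ*ℕ -[1+ n ] s = 0 , suc n ℕ.* s , (begin-equality
    - fromℕ (suc n) * fromℕ s    ≈⟨ -‿distribˡ-* _ _ ⟨
    - (fromℕ (suc n) * fromℕ s)  ≈⟨ -‿cong (×1-homo-* (suc n) s) ⟨
    - fromℕ (suc n ℕ.* s)        ≈⟨ +-identityˡ _ ⟨
    0# - fromℕ (suc n ℕ.* s)     ∎)

  IsIntegral-- : ∀ {x y} → IsIntegral x → IsIntegral y → IsIntegral (x - y)
  IsIntegral-- {x} {y} (m , n , x≈) (m′ , n′ , y≈) = m ℕ.+ n′ , n ℕ.+ m′ , (begin-equality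
    x - y                          ≈⟨ +-cong x≈ (-‿cong y≈) ⟩
    (M - N) - (M′ - N′)            ≈⟨ +-congˡ (⁻¹-anti-homo‿- M′ N′) ⟩
    (M - N) + (N′ - M′)            ≈⟨ solve 4 (λ a b c d → (a :+ b) :+ (c :+ d) := (a :+ c) :+ (b :+ d))
                                       refl M (- N) N′ (- M′) ⟩
    (M + N′) + (- N - M′)          ≈⟨ +-congˡ (⁻¹-∙-comm N M′) ⟩
    (M + N′) - (N + M′)            ≈⟨ +-cong (×-homo-+ 1# m n′) (-‿cong (×-homo-+ 1# n m′)) ⟨
    fromℕ (m ℕ.+ n′) - fromℕ (n ℕ.+ m′)  ∎)
    where
    M = fromℕ m
    N = fromℕ n
    M′ = fromℕ m′
    N′ = fromℕ n′

  -- With `x = m - n`, the bound on `x` forces `m ≤ n` and the bound on `- x` forces `n ≤ m`.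
  IsIntegral∧∣x∣<1⇒x≈0 : ∀ {x} → IsIntegral x → x < 1# → - x < 1# → x ≈ 0#
  IsIntegral∧∣x∣<1⇒x≈0 {x} (m , n , x≈) x<1 -x<1 = begin-equality
    x                  ≈⟨ x≈ ⟩
    fromℕ m - fromℕ n  ≡⟨ ≡.cong (λ k → fromℕ m - fromℕ k) (≡.sym m≡n) ⟩
    fromℕ m - fromℕ m  ≈⟨ -‿inverseʳ _ ⟩
    0#                 ∎
    where
    ∸<1⇒≤ : ∀ a b → fromℕ a - fromℕ b < 1# → a ℕ.≤ b
    ∸<1⇒≤ a b p = fromℕ-cancel-≤ a b (begin-strict
      fromℕ a                      ≈⟨ //-rightDividesˡ (fromℕ b) (fromℕ a) ⟨
      fromℕ a - fromℕ b + fromℕ b  ≈⟨ +-comm _ _ ⟩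
      fromℕ b + (fromℕ a - fromℕ b)  <⟨ +-monoʳ-< (fromℕ b) p ⟩
      fromℕ b + 1#                 ≈⟨ +-comm _ _ ⟩
      1# + fromℕ b                 ∎)
    m≡n : m ≡ n
    m≡n = ℕ.≤-antisym
      (∸<1⇒≤ m n (<-respˡ-≈ x≈ x<1))
      (∸<1⇒≤ n m (<-respˡ-≈ (trans (-‿cong x≈) (⁻¹-anti-homo‿- _ _)) -x<1))

  /-cancelʳ : ∀ {s} → 1 ℕ.≤ s → ∀ x → x / fromℕ s * fromℕ s ≈ x
  /-cancelʳ {s} 1≤s x = begin-equality
    x * S ⁻¹ * S    ≈⟨ solve 3 (λ x i s → x :* i :* s := x :* (s :* i)) refl x (S ⁻¹) S ⟩
    x * (S * S ⁻¹)  ≈⟨ *-congˡ (⁻¹-inverse λ e → proj₂ (0<fromℕ 1≤s) (sym e)) ⟩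
    x * 1#          ≈⟨ *-identityʳ x ⟩
    x               ∎
    where S = fromℕ s

  -- Clearing denominators gives the integer `(a - b) s t = p t - q s`. Since `s t` is at most `N²`,
  -- its absolute value is below 1, so it vanishes, and the positive factor `s t` cancels.
  rational-separation : ∀ {a b : Carrier} {p q s t N} → 1 ℕ.≤ s → s ℕ.≤ N → 1 ℕ.≤ t → t ℕ.≤ N →
    a ≈ fromℤ p / fromℕ s → b ≈ fromℤ q / fromℕ t →
    ∣ a - b ∣ʳ * (fromℕ N * fromℕ N) < 1# → a ≈ b
  rational-separation {a} {b} {p} {q} {s} {t} {N} 1≤s s≤N 1≤t t≤N a≈ b≈ close =
    x∙y⁻¹≈ε⇒x≈y a b (*-cancelˡ-≈ (λ e → proj₂ 0<st (sym e)) (begin-equality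
      S * T * (a - b)  ≈⟨ *-comm _ _ ⟩
      -- The absolute value is the maximum of a number and its negative, so `small` covers both
      -- signs.
      (a - b) * (S * T)  ≈⟨ IsIntegral∧∣x∣<1⇒x≈0 integral (small (x≤x⊔y _ _))
                              (<-respˡ-≈ (sym (-‿distribˡ-* _ _)) (small (x≤y⊔x _ _))) ⟩
      0#               ≈⟨ zeroʳ _ ⟨
      S * T * 0#       ∎))
    where
    S = fromℕ s
    T = fromℕ t
    0<st : 0# < S * T
    0<st = <-respˡ-≈ (zeroʳ S) (*-monoˡ-< (0<fromℕ 1≤s) (0<fromℕ 1≤t))
    st≤NN : S * T ≤ fromℕ N * fromℕ N
    st≤NN = ≤-trans (*-monoˡ-≤ (0≤fromℕ s) (fromℕ-mono-≤ t≤N))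
                    (*-monoʳ-≤ (0≤fromℕ N) (fromℕ-mono-≤ s≤N))
    0≤∣∣ : ∀ x → 0# ≤ ∣ x ∣ʳ
    0≤∣∣ x with total 0# x
    ... | inj₁ 0≤x = x≤y⇒x≤y⊔z _ 0≤x
    ... | inj₂ x≤0 = x≤y⇒x≤z⊔y _ (≤-respʳ-≈ (+-identityˡ (- x)) (x≤y⇒0≤y-x x≤0))
    small : ∀ {u} → u ≤ ∣ a - b ∣ʳ → u * (S * T) < 1#
    small {u} u≤ = begin-strict
      u * (S * T)                          ≤⟨ *-monoʳ-≤ (proj₁ 0<st) u≤ ⟩
      ∣ a - b ∣ʳ * (S * T)                 ≤⟨ *-monoˡ-≤ (0≤∣∣ _) st≤NN ⟩
      ∣ a - b ∣ʳ * (fromℕ N * fromℕ N)  <⟨ close ⟩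
      1#                                   ∎
    numerators : (a - b) * (S * T) ≈ fromℤ p * T - fromℤ q * S
    numerators = begin-equality
      (a - b) * (S * T)              ≈⟨ [y-z]x≈yx-zx _ _ _ ⟩
      a * (S * T) - b * (S * T)      ≈⟨ +-cong
        (trans (*-congʳ a≈) (trans (sym (*-assoc _ _ _)) (*-congʳ (/-cancelʳ 1≤s _))))
        (-‿cong (trans (*-cong b≈ (*-comm S T)) (trans (sym (*-assoc _ _ _))
          (*-congʳ (/-cancelʳ 1≤t _))))) ⟩
      fromℤ p * T - fromℤ q * S      ∎
    integral : IsIntegral ((a - b) * (S * T))
    integral with IsIntegral-- (IsIntegral-ℤ*ℕ p t) (IsIntegral-ℤ*ℕ q s)
    ... | m , n , e = m , n , trans numerators e

  -- Coordinates are treated one at a time: the norm dominates each of them, and all coordinates of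
  -- a point share one denominator of size at most `N`.
  𝒮-separation : ∀ {d} {C : Pred (Point d) 0ℓ} {N x y} → x ∈ 𝒮 C N → y ∈ 𝒮 C N →
                 ‖ x ⊖ y ‖ * (fromℕ N * fromℕ N) < 1# → x ≋ y
  𝒮-separation {N = N} {x} {y} (_ , p , _ , _ , 1≤s , s≤N , x≋) (_ , q , _ , _ , 1≤t , t≤N , y≋)
    close i =
    rational-separation {p = p i} {q = q i} 1≤s s≤N 1≤t t≤N (x≋ i) (y≋ i) (begin-strict
      ∣ x i - y i ∣ʳ * (fromℕ N * fromℕ N)  ≤⟨ *-monoʳ-≤ (0≤fromℕ² N) (∣zᵢ∣≤‖z‖ (x ⊖ y) i) ⟩
      ‖ x ⊖ y ‖ * (fromℕ N * fromℕ N)       <⟨ close ⟩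
      1#                                    ∎)

  -- Cells of the attractor and their widths

  module Attractor {d J} (F : Vector (Point d → Point d) J) (τs : Vector Carrier J)
    (C : Pred (Point d) 0ℓ) (τ diam : Carrier)
    (contraction : ∀ j → IsContraction (F j) (τs j)) (attractor : IsAttractor F C)
    (maximumRate : IsMaximumRate τs τ) (diameter : IsDiameter C diam) where

    -- The index encodes a word of length `k` in the maps as a number in base `J`, its leading digit
    -- naming the outermost map. The number of cells is thus visible in the type.
    cell : ∀ k → Fin (J ℕ.^ k) → Pred (Point d) 0ℓ
    cell zero    _ = C
    cell (suc k) i = let j , i′ = remQuot (J ℕ.^ k) i in image (F j) (cell k i′)

    -- The inclusion of `C` in the union of its images is unrolled `k` times: the preimage lies in
    -- `C`, hence in a cell of the previous level, and `combine` prepends the digit of the map.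
    cell-covers : ∀ k {x} → x ∈ C → ∃[ i ] x ∈ cell k i
    cell-covers zero    x∈ = zero , x∈
    cell-covers (suc k) {x} x∈ with proj₂ (proj₂ (proj₂ attractor)) x∈
    ... | j , x′ , x′∈ , x≋ with cell-covers k x′∈
    ...   | i , x′∈i = combine j i ,
      ≡.subst (λ ji → x ∈ image (F (proj₁ ji)) (cell k (proj₂ ji)))
              (≡.sym (remQuot-combine j i)) (x′ , x′∈i , x≋)

    1≤J : 1 ℕ.≤ J
    1≤J = ℕ.>-nonZero⁻¹ J {{nonZeroIndex (proj₁ (proj₁ maximumRate))}}

    0<τ : 0# < τ
    0<τ = let j , τ≈ = proj₁ maximumRate in <-respʳ-≈ (sym τ≈) (proj₁ (contraction j))

    τ<1 : τ < 1#
    τ<1 = let j , τ≈ = proj₁ maximumRate in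
      <-respˡ-≈ (sym τ≈) (proj₁ (proj₂ (contraction j)))

    -- This is `τ^k diam`, with the power in exponential form so that it merges with `exp M` in
    -- `narrow`.
    width : ℕ → Carrier
    width k = exp (fromℕ k * log τ) * diam

    width-0 : width 0 ≈ diam
    width-0 = begin-equality
      exp (0# * log τ) * diam  ≈⟨ *-congʳ (trans (exp-cong (zeroˡ _)) exp-0) ⟩
      1# * diam                ≈⟨ *-identityˡ diam ⟩
      diam                     ∎

    width-suc : ∀ k → width (suc k) ≈ τ * width k
    width-suc k = begin-equality
      exp ((1# + fromℕ k) * ℓ) * diam        ≈⟨ *-congʳ (exp-cong (distribʳ ℓ 1# (fromℕ k))) ⟩
      exp (1# * ℓ + fromℕ k * ℓ) * diam      ≈⟨ *-congʳ (exp-+ _ _) ⟩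
      exp (1# * ℓ) * exp (fromℕ k * ℓ) * diam ≈⟨ *-assoc _ _ _ ⟩
      exp (1# * ℓ) * width k                 ≈⟨ *-congʳ (trans (exp-cong (*-identityˡ ℓ)) (exp-log 0<τ)) ⟩
      τ * width k                            ∎
      where ℓ = log τ

    -- Each further map shrinks distances by its own rate, which is at most `τ`; at level 0 the
    -- diameter of `C` is the bound.
    cell-width : ∀ k i {x y} → x ∈ cell k i → y ∈ cell k i → ‖ x ⊖ y ‖ ≤ width k
    cell-width zero    i x∈ y∈ =
      ≤-respʳ-≈ (sym width-0) (proj₂ diameter (_ , _ , x∈ , y∈ , refl))
    cell-width (suc k) i {x} {y} (x′ , x′∈ , x≋) (y′ , y′∈ , y≋) = begin
      ‖ x ⊖ y ‖            ≈⟨ ⊖-cong-‖‖ x≋ y≋ ⟩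
      ‖ F j x′ ⊖ F j y′ ‖  ≤⟨ proj₂ (proj₂ (contraction j)) x′ y′ ⟩
      τs j * ‖ x′ ⊖ y′ ‖   ≤⟨ *-monoʳ-≤ (0≤‖‖ (x′ ⊖ y′)) (proj₂ maximumRate (j , refl)) ⟩
      τ * ‖ x′ ⊖ y′ ‖      ≤⟨ *-monoˡ-≤ (proj₁ 0<τ) (cell-width k i′ x′∈ y′∈) ⟩
      τ * width k          ≈⟨ width-suc k ⟨
      width (suc k)        ∎
      where
      j = proj₁ (remQuot (J ℕ.^ k) i)
      i′ = proj₂ (remQuot {J} (J ℕ.^ k) i)

    -- Narrow cells are thin on `𝒮 C N`: two of its points in a common cell are too close to be
    -- distinct. So there are at most as many points as cells.
    𝒮-cardinality-≤ : ExcludedMiddle 0ℓ → ∀ N k → width k * (fromℕ N * fromℕ N) < 1# →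
                      ∃[ n ] HasCardinality (𝒮 C N) n × n ℕ.≤ J ℕ.^ k
    𝒮-cardinality-≤ em N k narrow = Counting.cardinality-≤ em
      (On.setoid {B = ∃ (𝒮 C N)} (pointSetoid d) proj₁)
      (λ i → cell k i ∘ proj₁)
      (λ i {a} {b} a∈ b∈ → 𝒮-separation (proj₂ a) (proj₂ b) (begin-strict
        ‖ proj₁ a ⊖ proj₁ b ‖ * (fromℕ N * fromℕ N)  ≤⟨ *-monoʳ-≤ (0≤fromℕ² N) (cell-width k i a∈ b∈) ⟩
        width k * (fromℕ N * fromℕ N)                <⟨ narrow ⟩
        1#                                           ∎))
      (λ a → cell-covers k (proj₁ (proj₂ a)))

    -- The exponent and the final bound

    L : Carrier
    L = - log τ

    0<L : 0# < L
    0<L = <-respʳ-≈ (+-identityˡ L) (x<y⇒0<y-x (0<x<1⇒log<0 0<τ τ<1))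

    D : Carrier
    D = exponent J τ

    -- The logarithmic form of `J = τ^(-D)`.
    L*D≈logJ : L * D ≈ log (fromℕ J)
    L*D≈logJ = begin-equality
      - ℓ * (- l * ℓ ⁻¹)    ≈⟨ -‿distribˡ-* _ _ ⟨
      - (ℓ * (- l * ℓ ⁻¹))  ≈⟨ -‿cong (solve 3 (λ a b c → a :* (b :* c) := b :* (a :* c))
                                         refl ℓ (- l) (ℓ ⁻¹)) ⟩
      - (- l * (ℓ * ℓ ⁻¹))  ≈⟨ -‿cong (*-congˡ (⁻¹-inverse (proj₂ (0<x<1⇒log<0 0<τ τ<1)))) ⟩
      - (- l * 1#)          ≈⟨ -‿cong (*-identityʳ _) ⟩
      - - l                 ≈⟨ -‿involutive l ⟩
      l                     ∎
      where
      ℓ = log τ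
      l = log (fromℕ J)

    0≤D : 0# ≤ D
    0≤D = *-cancelˡ-≤ 0<L (begin
      L * 0#         ≈⟨ zeroʳ L ⟩
      0#             ≤⟨ 1≤x⇒0≤log (1≤fromℕ 1≤J) ⟩
      log (fromℕ J)  ≈⟨ L*D≈logJ ⟨
      L * D          ∎)

    0<D : 2 ℕ.≤ J → 0# < D
    -- A vanishing `D` would make `log J = L D` vanish, but `J > 1` has a positive logarithm.
    0<D 2≤J = 0≤D , λ 0≈D → proj₂ (1<x⇒0<log 1<J) (begin-equality
      0#             ≈⟨ zeroʳ L ⟨
      L * 0#         ≈⟨ *-congˡ 0≈D ⟩
      L * D          ≈⟨ L*D≈logJ ⟩
      log (fromℕ J)  ∎)
      where
      1<J : 1# < fromℕ J
      1<J = begin-strict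
        1#             ≈⟨ +-identityʳ 1# ⟨
        1# + 0#        <⟨ +-monoʳ-< 1# 0<1 ⟩
        1# + 1#        ≈⟨ +-congˡ fromℕ-1 ⟨
        fromℕ 2        ≤⟨ fromℕ-mono-≤ 2≤J ⟩
        fromℕ J        ∎

    module Large (N : ℕ) (1≤diamNN : 1# ≤ diam * (fromℕ N * fromℕ N)) where
      -- Positivity of `N`, and of `diam` below, is what `exp-log` and `^-positive` require.
      1≤N : 1 ℕ.≤ N
      1≤N = ℕ.n≢0⇒n>0 λ N≡0 → <⇒≱ 0<1 (begin
        1#                          ≤⟨ 1≤diamNN ⟩
        diam * (fromℕ N * fromℕ N)  ≡⟨ ≡.cong (λ n → diam * (fromℕ n * fromℕ N)) N≡0 ⟩
        diam * (0# * fromℕ N)       ≈⟨ trans (*-congˡ (zeroˡ _)) (zeroʳ _) ⟩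
        0#                          ∎)

      0<diam : 0# < diam
      0<diam with diam ≤? 0#
      ... | no  diam≰0 = ≰⇒> diam≰0
      ... | yes diam≤0 = contradiction (begin
        1#                            ≤⟨ 1≤diamNN ⟩
        diam * (fromℕ N * fromℕ N)    ≤⟨ *-monoʳ-≤ (0≤fromℕ² N) diam≤0 ⟩
        0# * (fromℕ N * fromℕ N)      ≈⟨ zeroˡ _ ⟩
        0#                            ∎) (<⇒≱ 0<1)

      -- M = log (diam N²) and L = −log τ, so τᵏ diam < N⁻² if and only if M < k L.
      M : Carrier
      M = log diam + (log (fromℕ N) + log (fromℕ N))

      exp-M : exp M ≈ diam * (fromℕ N * fromℕ N)
      exp-M = trans (exp-+ _ _) (*-cong (exp-log 0<diam)
        (trans (exp-+ _ _) (*-cong (exp-log (0<fromℕ 1≤N)) (exp-log (0<fromℕ 1≤N)))))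

      0≤M : 0# ≤ M
      0≤M = exp-cancel-≤ (begin
        exp 0#                      ≈⟨ exp-0 ⟩
        1#                          ≤⟨ 1≤diamNN ⟩
        diam * (fromℕ N * fromℕ N)  ≈⟨ exp-M ⟨
        exp M                       ∎)

      narrow : ∀ k → M < fromℕ k * L → width k * (fromℕ N * fromℕ N) < 1#
      narrow k M<kL = begin-strict
        width k * (fromℕ N * fromℕ N)     ≈⟨ *-assoc _ _ _ ⟩
        exp kℓ * (diam * (fromℕ N * fromℕ N))  ≈⟨ *-congˡ exp-M ⟨
        exp kℓ * exp M                    ≈⟨ exp-+ _ _ ⟨
        exp (kℓ + M)                      <⟨ exp-mono-< (+-monoʳ-< kℓ M<kL) ⟩
        exp (kℓ + fromℕ k * L)            ≈⟨ exp-cong (+-congˡ (-‿distribʳ-* _ _)) ⟨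
        exp (kℓ - kℓ)                     ≈⟨ exp-cong (-‿inverseʳ kℓ) ⟩
        exp 0#                            ≈⟨ exp-0 ⟩
        1#                                ∎
        where kℓ = fromℕ k * log τ

      -- Here `m log J = m L D`, and multiplying `m L ≤ M` by the nonnegative `D` bounds it by
      -- `M D`.
      J^m≤exp : ∀ m → fromℕ m * L ≤ M → fromℕ (J ℕ.^ m) ≤ exp (M * D)
      J^m≤exp m mL≤M = begin
        fromℕ (J ℕ.^ m)                ≈⟨ exp-*-log-fromℕ m 1≤J ⟨
        exp (fromℕ m * log (fromℕ J))  ≈⟨ exp-cong (*-congˡ L*D≈logJ) ⟨
        exp (fromℕ m * (L * D))        ≈⟨ exp-cong (*-assoc _ _ _) ⟨
        exp (fromℕ m * L * D)          ≤⟨ exp-mono-≤ (*-monoʳ-≤ 0≤D mL≤M) ⟩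
        exp (M * D)                    ∎

      exp-M*D : exp (M * D) ≈ diam ^ D * fromℕ N ^ (fromℕ 2 * D)
      exp-M*D = begin-equality
        exp (M * D)  ≈⟨ exp-cong (solve 3 (λ a b c → (a :+ (b :+ b)) :* c :=
                        c :* a :+ (con 1 :+ (con 1 :+ con 0)) :* c :* b) refl a b D) ⟩
        exp (D * a + fromℕ 2 * D * b)  ≈⟨ exp-+ _ _ ⟩
        exp (D * a) * exp (fromℕ 2 * D * b)  ≈⟨
          *-cong (^-positive 0<diam D) (^-positive (0<fromℕ 1≤N) (fromℕ 2 * D)) ⟨
        diam ^ D * fromℕ N ^ (fromℕ 2 * D) ∎
        where
        a = log diam
        b = log (fromℕ N)

      -- The last level costs one factor `J` beyond `J^m`; it is enlarged to `J²` to reach the form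
      -- of `bound`.
      J^[1+m]≤bound : ∀ m → fromℕ m * L ≤ M → fromℕ (J ℕ.^ suc m) ≤ bound J diam D N
      J^[1+m]≤bound m mL≤M = begin
        fromℕ (J ℕ.* J ℕ.^ m)        ≈⟨ ×1-homo-* J (J ℕ.^ m) ⟩
        fromℕ J * fromℕ (J ℕ.^ m)    ≤⟨ *-monoˡ-≤ (0≤fromℕ J) (J^m≤exp m mL≤M) ⟩
        fromℕ J * exp (M * D)        ≤⟨ *-monoʳ-≤ (proj₁ (0<exp _)) (fromℕ-mono-≤ J≤J²) ⟩
        fromℕ (J ℕ.^ 2) * exp (M * D)  ≈⟨ *-congˡ exp-M*D ⟩
        fromℕ (J ℕ.^ 2) * (diam ^ D * fromℕ N ^ (fromℕ 2 * D))  ≈⟨ *-assoc _ _ _ ⟨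
        bound J diam D N             ∎
        where
        J≤J² : J ℕ.≤ J ℕ.^ 2
        J≤J² = ℕ.m≤m*n J (J ℕ.^ 1) {{ℕ.m^n≢0 J 1 {{ℕ.>-nonZero 1≤J}}}}

    cardinality : ExcludedMiddle 0ℓ → ∀ N →
      ∃[ n ] HasCardinality (𝒮 C N) n × fromℕ n ≤ 1# ⊔ bound J diam D N
    cardinality em N = case (1# ≤? diam * (fromℕ N * fromℕ N))
      where
      case : Dec (1# ≤ diam * (fromℕ N * fromℕ N)) →
             ∃[ n ] HasCardinality (𝒮 C N) n × fromℕ n ≤ 1# ⊔ bound J diam D N
      -- Here `diam N² < 1`, so the single cell `C` of level 0 is already narrow. This case accounts
      -- for the 1 in the maximum.
      case (no 1≰) =
        let n , card , n≤1 = 𝒮-cardinality-≤ em N 0 (<-respˡ-≈ (*-congʳ (sym width-0)) (≰⇒> 1≰))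
        in n , card , x≤y⇒x≤y⊔z _ (≤-respʳ-≈ fromℕ-1 (fromℕ-mono-≤ n≤1))
      case (yes 1≤) =
        let open Large N 1≤
            -- `m` is the integer part of `M / L`: level `suc m` is narrow enough, while `m L ≤ M`
            -- still controls `J^m`.
            m , mL≤M , M<[1+m]L = floor em 0<L 0≤M
            n , card , n≤ = 𝒮-cardinality-≤ em N (suc m) (narrow (suc m) M<[1+m]L)
        in n , card , x≤y⇒x≤z⊔y _ (≤-trans (fromℕ-mono-≤ n≤) (J^[1+m]≤bound m mL≤M))

theorem4p1 : ExcludedMiddle 0ℓ →
    (ℝ : CompleteOrderedField) (E : Exponential ℝ) →
    let open Euclidean ℝ E in
    (d J : ℕ)
    (F : Vector (Point d → Point d) J) (τs : Vector Carrier J)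
    (C : Pred (Point d) 0ℓ) (τ diam : Carrier) →
    ((j : Fin J) → IsContraction (F j) (τs j)) →
    IsAttractor F C →
    IsMaximumRate τs τ →
    IsDiameter C diam →
    let D = exponent J τ in
    (2 ℕ.≤ J → 0# < D) ×
    ((N : ℕ) → ∃[ n ] HasCardinality (𝒮 C N) n × fromℕ n ≤ 1# ⊔ bound J diam D N)
theorem4p1 em ℝ E d J F τs C τ diam contraction attractor maximumRate diameter =
  0<D , cardinality em
  where
  open Analysis ℝ E
  open Attractor F τs C τ diam contraction attractor maximumRate diameter
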